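{- Let $\mathbf M=(m_1,\dots,m_r)$ be any Motzkin path. Then for every $\alpha\in I_r$ and every $n\in\mathbb Z$ there is a Laurent polynomial $f$ in $2r$ variables with nonnegative integer coefficients such that $$R_{\alpha,n}=f\bigl(R_{1,m_1},\dots,R_{r,m_r},R_{1,m_1+1},\dots,R_{r,m_r+1}\bigr).$$
   Context: Fix $r\ge1$, $I_r=\{1,\dots,r\}$. Let $R_{1,0},\dots,R_{r,0},R_{1,1},\dots,R_{r,1}$ be algebraically independent indeterminates over $\mathbb Q$ and $(R_{\alpha,n})_{0\le\alpha\le r+1,n\in\mathbb Z}$ the $A_r$ $Q$-system: the unique family of nonzero elements of $\mathbb Q(R_{1,0},\dots,R_{r,1})$ with these initial values, $R_{0,n}=R_{r+1,n}=1$, and $R_{\alpha,n+1}R_{\alpha,n-1}=R_{\alpha,n}^2+R_{\alpha+1,n}R_{\alpha-1,n}$ ($\alpha\in I_r$, $n\in\mathbb Z$). A Motzkin path is $\mathbf M=(m_1,\dots,m_r)\in\mathbb Z^r$ with $|m_{\alpha+1}-m_\alpha|\le1$ for $1\le\alpha<r$; the elements $R_{\alpha,m_\alpha},R_{\alpha,m_\alpha+1}$ ($\alpha\in I_r$) then form a set of $2r$ algebraically independent generators of the same field. -}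

module Defs where

open import Level using (Level; _⊔_) renaming (suc to lsuc)
open import Algebra.Bundles using (CommutativeRing; Semiring)
open import Algebra.Morphism.Structures using (module RingMorphisms)
import Algebra.Definitions.RawSemiring as RawSemiringDefs
open import Data.Fin.Base using (Fin; zero; suc; inject₁; fromℕ; toℕ)
open import Data.Integer.Base as ℤ using (ℤ; +_; -[1+_]; 0ℤ; 1ℤ)
open import Data.List.Base using (List; []; _∷_; foldr)
open import Data.Nat.Base as ℕ using (ℕ)
import Data.Nat.Properties as ℕ
open import Data.Product.Base using (Σ; ∃; _×_; _,_; proj₁)
open import Data.Rational.Base as ℚ using (ℚ; 0ℚ)
open import Data.Vec.Base using (Vec; lookup)
open import Data.Vec.Functional using (Vector; _++_)
open import Data.Vec.Properties using (≡-dec)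
open import Relation.Binary.PropositionalEquality.Core using (_≡_)
open import Relation.Nullary.Decidable.Core using (yes; no)
open import Relation.Nullary.Negation.Core using (¬_)

private
  variable
    k r : ℕ

record Field (c ℓ : Level) : Set (lsuc (c ⊔ ℓ)) where
  field
    commutativeRing : CommutativeRing c ℓ

  open CommutativeRing commutativeRing public
  open RawSemiringDefs (Semiring.rawSemiring semiring) public
    using (_^_; product) renaming (_×_ to _·_)

  field
    1≉0     : ¬ (1# ≈ 0#)
    inverse : ∀ x → ¬ (x ≈ 0#) → ∃ λ y → x * y ≈ 1#

  Nonzero : Set (c ⊔ ℓ)
  Nonzero = Σ Carrier λ x → ¬ (x ≈ 0#)

  infix 9 _⁻¹
  _⁻¹ : Nonzero → Carrier
  (x , x≉0) ⁻¹ = proj₁ (inverse x x≉0)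

  infixr 8 _^ℤ_
  _^ℤ_ : Nonzero → ℤ → Carrier
  x ^ℤ (+ n)    = proj₁ x ^ n
  x ^ℤ -[1+ n ] = (x ⁻¹) ^ ℕ.suc n

-- Finite formal sums of terms (coefficient , exponent vector).  An exponent
-- vector may occur more than once; its coefficient is then the sum of the
-- coefficients of its occurrences.
Polynomialℚ : ℕ → Set
Polynomialℚ k = List (ℚ × Vec ℕ k)

LaurentPolynomialℕ : ℕ → Set
LaurentPolynomialℕ k = List (ℕ × Vec ℤ k)

coefficient : Vec ℕ k → Polynomialℚ k → ℚ
coefficient e [] = 0ℚ
coefficient e ((a , d) ∷ p) with ≡-dec ℕ._≟_ d e
... | yes _ = a ℚ.+ coefficient e p
... | no  _ = coefficient e p

module _ {c ℓ} (K : Field c ℓ) where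
  open Field K

  evalPolynomial : (ℚ → Carrier) → Polynomialℚ k → Vector Carrier k → Carrier
  evalPolynomial ι p x =
    foldr (λ (a , e) s → ι a * product (λ i → x i ^ lookup e i) + s) 0# p

  evalLaurent : LaurentPolynomialℕ k → Vector Nonzero k → Carrier
  evalLaurent f x =
    foldr (λ (a , e) s → a · product (λ i → x i ^ℤ lookup e i) + s) 0# f

  AlgebraicallyIndependent : (ℚ → Carrier) → Vector Carrier k → Set ℓ
  AlgebraicallyIndependent ι x =
    ∀ p → evalPolynomial ι p x ≈ 0# → ∀ e → coefficient e p ≡ 0ℚ

  Generates : (ℚ → Carrier) → Vector Carrier k → Set (c ⊔ ℓ)
  Generates ι x = ∀ z → ∃ λ p → ∃ λ q →
    ¬ (evalPolynomial ι q x ≈ 0#) × z * evalPolynomial ι q x ≈ evalPolynomial ι p x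

-- The field ℚ(x₁,…,xₖ), given up to isomorphism: an extension of ℚ generated,
-- as a field, by k algebraically independent elements.
record RationalFunctionField (k : ℕ) (c ℓ : Level) : Set (lsuc (c ⊔ ℓ)) where
  field
    asField : Field c ℓ

  open Field asField public
  open RingMorphisms ℚ.+-*-rawRing rawRing using (IsRingHomomorphism)

  field
    ι                 : ℚ → Carrier
    ι-isHomomorphism  : IsRingHomomorphism ι
    indeterminate     : Vector Carrier k
    algIndependent    : AlgebraicallyIndependent asField ι indeterminate
    generates         : Generates asField ι indeterminate

-- The indices 0,…,r+1 are the elements of Fin (2 + r), and I_r = {1,…,r} is
-- represented by Fin r, where i stands for α = toℕ i + 1.
⟨_⟩ ⟨_⟩+1 ⟨_⟩-1 : Fin r → Fin (2 ℕ.+ r)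
⟨ i ⟩   = suc (inject₁ i)
⟨ i ⟩+1 = suc (suc i)
⟨ i ⟩-1 = inject₁ (inject₁ i)

module _ {c ℓ} (K : RationalFunctionField (r ℕ.+ r) c ℓ) where
  open RationalFunctionField K hiding (zero)

  -- (R_{1,m₁},…,R_{r,m_r},R_{1,m₁+1},…,R_{r,m_r+1})
  initialData : (Fin (2 ℕ.+ r) → ℤ → Nonzero) → Vector ℤ r → Vector Nonzero (r ℕ.+ r)
  initialData R m = (λ i → R ⟨ i ⟩ (m i)) ++ (λ i → R ⟨ i ⟩ (m i ℤ.+ 1ℤ))

  record IsQSystem (R : Fin (2 ℕ.+ r) → ℤ → Nonzero) : Set ℓ where
    private
      R′ : Fin (2 ℕ.+ r) → ℤ → Carrier
      R′ α n = proj₁ (R α n)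
    field
      initial       : ∀ j → proj₁ (initialData R (λ _ → 0ℤ) j) ≈ indeterminate j
      lowerBoundary : ∀ n → R′ zero n ≈ 1#
      upperBoundary : ∀ n → R′ (fromℕ (ℕ.suc r)) n ≈ 1#
      recurrence    : ∀ i n →
        R′ ⟨ i ⟩ (n ℤ.+ 1ℤ) * R′ ⟨ i ⟩ (n ℤ.- 1ℤ)
          ≈ R′ ⟨ i ⟩ n ^ 2 + R′ ⟨ i ⟩+1 n * R′ ⟨ i ⟩-1 n

IsMotzkinPath : Vector ℤ r → Set
IsMotzkinPath m = ∀ i j → toℕ j ≡ ℕ.suc (toℕ i) → ℤ.∣ m j ℤ.- m i ∣ ℕ.≤ 1

{-# OPTIONS --safe #-}
module Submission where

-- The group GL_{r+1} acts on the exterior algebra of its standard representation, whose basis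
-- is indexed by bit strings of length r + 1.  To a Motzkin path M one attaches a Coxeter-like
-- product G of lower triangular factors with diagonal entries R_{α,m+1}/R_{α,m} and a product
-- E of elementary upper triangular factors whose entries are positive Laurent monomials in the
-- initial data at M; the order of the factors is dictated by the edges of M.  The Q-system
-- relation is precisely the 2×2 exchange that yields E_M G_M = G_{M+1} E_{M+1}.  Hence
-- (G_M E_M)^(n+1) = G_M (G_{M+1} E_{M+1})^n E_M.  Applying this to the sum ω of the strings
-- 1…10…0, which E_M fixes, shows by induction on n that R_{α,m_α} times the coefficient of
-- 1^α 0^(r+1-α) in (G_M E_M)^n ω equals R_{α,m_α+n}; that coefficient is visibly a polynomial
-- with nonnegative coefficients in the matrix entries.

open import Defs
open import Algebra.Bundles using (CommutativeSemiring)
import Algebra.Properties.CommutativeMonoid.Sum as ProductProperties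
import Algebra.Properties.Monoid.Mult as MonoidMult
import Algebra.Properties.Semiring.Exp as Exp
import Algebra.Properties.Semiring.Mult as SemiringMult
import Algebra.Solver.Ring.NaturalCoefficients.Default as NaturalSolver
open import Data.Bool.Base using (Bool; true; false)
open import Data.Fin.Base using (Fin; zero; suc; fromℕ; inject₁; _↑ˡ_; _↑ʳ_)
open import Data.Fin.Properties using (toℕ-inject₁)
open import Data.Integer.Base as ℤ using (ℤ)
import Data.Integer.Properties as ℤ
open import Data.List.Base using ([]; _∷_; _++_)
open import Data.Nat.Base as ℕ using (ℕ; zero; suc; _+_; _≤_; s≤s)
open import Data.Nat.GeneralisedArithmetic using (fold)
import Data.Nat.Properties as ℕ
open import Data.Product.Base using (∃; _×_; _,_; proj₁; proj₂)
open import Data.Sum.Base using (_⊎_; inj₁; inj₂)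
open import Data.Vec.Base using (Vec; []; _∷_; lookup; replicate; zipWith; _[_]≔_)
open import Data.Vec.Functional using (Vector)
open import Data.Vec.Functional.Properties using (lookup-++ˡ; lookup-++ʳ)
open import Data.Vec.Properties using (lookup-zipWith)
open import Function.Base using (_∘_; id)
open import Level using (_⊔_)
open import Relation.Binary.Bundles using (Setoid)
open import Relation.Binary.PropositionalEquality.Core as ≡ using (_≡_)
import Relation.Binary.Reasoning.Setoid as SetoidReasoning

-- Operators on the exterior algebra, in coordinates indexed by bit strings.

module Fock {c ℓ} (S : CommutativeSemiring c ℓ) where
  open CommutativeSemiring S hiding (zero) renaming (_+_ to _⊕_)
  open NaturalSolver S using (solve; _:=_; _:+_; _:*_; con)

  private
    variable
      n : ℕ

  State : ℕ → Set c
  State n = Vec Bool n → Carrier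

  Operator : ℕ → Set c
  Operator n = State n → State n

  stateSetoid : ℕ → Setoid c ℓ
  stateSetoid n = record
    { Carrier       = State n
    ; _≈_           = λ f h → ∀ v → f v ≈ h v
    ; isEquivalence = record
      { refl  = λ v → refl
      ; sym   = λ e v → sym (e v)
      ; trans = λ e e′ v → trans (e v) (e′ v)
      }
    }

  infix 4 _≐_
  _≐_ : State n → State n → Set ℓ
  f ≐ h = ∀ v → f v ≈ h v

  -- Two-term combinations are exactly the form in which `local` mixes coefficients; compatibility
  -- with them is what `local-lift-lift` uses.
  record IsLinear (Y : Operator n) : Set (c ⊔ ℓ) where
    field
      ≐-cong      : ∀ {f h} → f ≐ h → Y f ≐ Y h
      combination : ∀ a b f h →
        Y (λ v → a * f v ⊕ b * h v) ≐ λ v → a * Y f v ⊕ b * Y h v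

    null : Y (λ _ → 0#) ≐ λ _ → 0#
    null v = trans (≐-cong (λ _ → sym vanish) v) (trans (combination 0# 0# (λ _ → 0#) (λ _ → 0#) v) vanish)
      where
      vanish : ∀ {z w} → 0# * z ⊕ 0# * w ≈ 0#
      vanish = trans (+-cong (zeroˡ _) (zeroˡ _)) (+-identityˡ 0#)

  open IsLinear public

  id-linear : IsLinear {n} id
  id-linear = record { ≐-cong = id ; combination = λ a b f h v → refl }

  ∘-linear : {Y Z : Operator n} → IsLinear Y → IsLinear Z → IsLinear (Y ∘ Z)
  ∘-linear Y-lin Z-lin = record
    { ≐-cong      = λ e → ≐-cong Y-lin (≐-cong Z-lin e)
    ; combination = λ a b f h v → trans
        (≐-cong Y-lin (combination Z-lin a b f h) v)
        (combination Y-lin a b _ _ v)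
    }

  -- Tensoring with the identity on the first position. No sign appears: the group elements
  -- concerned fix the first basis vector, hence commute with wedging by it from the left.
  lift : Operator n → Operator (suc n)
  lift Y f (b ∷ v) = Y (λ w → f (b ∷ w)) v

  lift-cong : {Y Z : Operator n} → (∀ f → Y f ≐ Z f) → ∀ f → lift Y f ≐ lift Z f
  lift-cong e f (b ∷ v) = e _ v

  lift-∘ : (Y Z : Operator n) → ∀ f → lift (Y ∘ Z) f ≐ lift Y (lift Z f)
  lift-∘ Y Z f (b ∷ v) = refl

  lift-id : ∀ f → lift {n} id f ≐ f
  lift-id f (b ∷ v) = refl

  lift-linear : {Y : Operator n} → IsLinear Y → IsLinear (lift Y)
  lift-linear Y-lin = record
    { ≐-cong      = λ { e (b ∷ v) → ≐-cong Y-lin (λ w → e (b ∷ w)) v }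
    ; combination = λ { a b f h (d ∷ v) → combination Y-lin a b _ _ v }
    }

  lift-exchange : {X Y X′ Y′ : Operator n} → (∀ f → X (Y f) ≐ Y′ (X′ f)) →
    ∀ f → lift X (lift Y f) ≐ lift Y′ (lift X′ f)
  lift-exchange e f (b ∷ v) = e _ v

  record Matrix : Set c where
    constructor matrix
    field
      a₁₁ a₁₂ a₂₁ a₂₂ : Carrier

  -- On the exterior algebra of a plane the pattern 11 is scaled by the determinant, which is 1
  -- for all matrices used here.
  local : Matrix → Operator (2 + n)
  local (matrix a b _ _) f (true  ∷ false ∷ v) = a * f (true ∷ false ∷ v) ⊕ b * f (false ∷ true ∷ v)
  local (matrix _ _ c d) f (false ∷ true  ∷ v) = c * f (true ∷ false ∷ v) ⊕ d * f (false ∷ true ∷ v)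
  local _                f (true  ∷ true  ∷ v) = f (true ∷ true ∷ v)
  local _                f (false ∷ false ∷ v) = f (false ∷ false ∷ v)

  upper : Carrier → Matrix
  upper a = matrix 1# a 0# 1#

  -- The lower left entry is normalised to 1, a form that the exchange with `upper` preserves.
  lower : Carrier → Carrier → Matrix
  lower p q = matrix p 0# 1# q

  private
    exchange-combination : ∀ a b s t z w z′ w′ →
      s * (a * z ⊕ b * w) ⊕ t * (a * z′ ⊕ b * w′) ≈ a * (s * z ⊕ t * z′) ⊕ b * (s * w ⊕ t * w′)
    exchange-combination = solve 8 (λ a b s t z w z′ w′ →
      s :* (a :* z :+ b :* w) :+ t :* (a :* z′ :+ b :* w′)
        := a :* (s :* z :+ t :* z′) :+ b :* (s :* w :+ t :* w′)) refl

  local-linear : ∀ A → IsLinear (local {n} A)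
  local-linear A = record
    { ≐-cong      = local-≐
    ; combination = local-combination
    }
    where
    local-≐ : ∀ {f h} → f ≐ h → local A f ≐ local A h
    local-≐ e (true  ∷ false ∷ v) = +-cong (*-congˡ (e _)) (*-congˡ (e _))
    local-≐ e (false ∷ true  ∷ v) = +-cong (*-congˡ (e _)) (*-congˡ (e _))
    local-≐ e (true  ∷ true  ∷ v) = e _
    local-≐ e (false ∷ false ∷ v) = e _

    local-combination : ∀ a b f h →
      local A (λ v → a * f v ⊕ b * h v) ≐ λ v → a * local A f v ⊕ b * local A h v
    local-combination a b f h (true  ∷ false ∷ v) = exchange-combination a b _ _ _ _ _ _
    local-combination a b f h (false ∷ true  ∷ v) = exchange-combination a b _ _ _ _ _ _
    local-combination a b f h (true  ∷ true  ∷ v) = refl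
    local-combination a b f h (false ∷ false ∷ v) = refl

  upper-cong : ∀ {a b} → a ≈ b → (f : State (2 + n)) → local (upper a) f ≐ local (upper b) f
  upper-cong e f (true  ∷ false ∷ v) = +-congˡ (*-congʳ e)
  upper-cong e f (false ∷ true  ∷ v) = refl
  upper-cong e f (true  ∷ true  ∷ v) = refl
  upper-cong e f (false ∷ false ∷ v) = refl

  -- The two operators act on disjoint positions. Where `local A` mixes two coefficients, the
  -- equality is the linearity of `Y`.
  local-lift-lift : ∀ A {Y : Operator n} → IsLinear Y →
    ∀ f → local A (lift (lift Y) f) ≐ lift (lift Y) (local A f)
  local-lift-lift A Y-lin f (true  ∷ false ∷ v) = sym (combination Y-lin _ _ _ _ v)
  local-lift-lift A Y-lin f (false ∷ true  ∷ v) = sym (combination Y-lin _ _ _ _ v)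
  local-lift-lift A Y-lin f (true  ∷ true  ∷ v) = refl
  local-lift-lift A Y-lin f (false ∷ false ∷ v) = refl

  private
    absorb : ∀ {p q} → q * p ≈ 1# → ∀ a w → q * (a * p * w) ≈ a * w
    absorb {p} {q} qp≈1 a w = trans
      (solve 4 (λ q a p w → q :* (a :* p :* w) := (q :* p) :* (a :* w)) refl q a p w)
      (trans (*-congʳ qp≈1) (*-identityˡ _))

    -- In each of the two relations below a single bit pattern calls for `q * p ≈ 1#`: 101 in the
    -- first, 010 in the second. Both reduce to this identity.
    dual : ∀ {p q} → q * p ≈ 1# → ∀ a s t w →
      1# * (1# * s ⊕ q * t) ⊕ a * w ≈ 1# * s ⊕ q * (1# * t ⊕ a * p * w)
    dual {p} {q} qp≈1 a s t w = trans (+-congˡ (sym (absorb qp≈1 a w)))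
      (solve 6 (λ q s t a p w →
        con 1 :* (con 1 :* s :+ q :* t) :+ q :* (a :* p :* w)
          := con 1 :* s :+ q :* (con 1 :* t :+ a :* p :* w)) refl q s t a p w)

  -- As 3×3 matrices: the second row of the lower factor is `p` times a unit vector and its first
  -- column is a unit vector, so moving the off-diagonal entry across multiplies it by `p`. The
  -- eight patterns check this on all exterior powers at once.
  upper-lift-lower : ∀ a {p q} → q * p ≈ 1# → (f : State (3 + n)) →
    local (upper a) (lift (local (lower p q)) f) ≐ lift (local (lower p q)) (local (upper (a * p)) f)
  upper-lift-lower a {p} qp≈1 f (true ∷ false ∷ false ∷ v) =
    solve 5 (λ s a p t w → con 1 :* s :+ a :* (p :* t :+ con 0 :* w)
      := con 1 :* s :+ (a :* p) :* t) refl _ a p _ _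
  upper-lift-lower a     qp≈1 f (true ∷ false ∷ true ∷ v) = dual qp≈1 a _ _ _
  upper-lift-lower a {p} qp≈1 f (false ∷ true ∷ false ∷ v) =
    solve 4 (λ s t w p → con 0 :* s :+ con 1 :* (p :* t :+ con 0 :* w)
      := p :* (con 0 :* s :+ con 1 :* t) :+ con 0 :* w) refl _ _ _ p
  upper-lift-lower a {p} {q} qp≈1 f (false ∷ true ∷ true ∷ v) =
    solve 4 (λ s t q w → con 0 :* (con 1 :* t :+ q :* s) :+ con 1 :* w
      := con 0 :* s :+ con 1 :* w) refl _ _ q _
  upper-lift-lower a {p} qp≈1 f (true ∷ true ∷ false ∷ v) =
    solve 4 (λ p s t w → p :* s :+ con 0 :* t
      := p :* s :+ con 0 :* (con 1 :* t :+ w)) refl p _ _ _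
  upper-lift-lower a     qp≈1 f (true ∷ true ∷ true ∷ v) = refl
  upper-lift-lower a     qp≈1 f (false ∷ false ∷ false ∷ v) = refl
  upper-lift-lower a {p} {q} qp≈1 f (false ∷ false ∷ true ∷ v) =
    solve 4 (λ s t q w → con 1 :* t :+ q :* s
      := con 1 :* (con 0 :* w :+ con 1 :* t) :+ q :* s) refl _ _ q _

  -- Here the off-diagonal entry meets the second column of the lower factor, which is `q` times a
  -- unit vector; dividing by `q` is multiplying by `p`.
  lift-upper-lower : ∀ a {p q} → q * p ≈ 1# → (f : State (3 + n)) →
    lift (local (upper a)) (local (lower p q) f) ≐ local (lower p q) (lift (local (upper (a * p))) f)
  lift-upper-lower a {p} qp≈1 f (true ∷ true ∷ false ∷ v) =
    solve 5 (λ s a p t w → con 1 :* s :+ a :* (p :* t :+ con 0 :* w)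
      := con 1 :* s :+ (a :* p) :* t) refl _ a p _ _
  lift-upper-lower a     qp≈1 f (false ∷ true ∷ false ∷ v) = dual qp≈1 a _ _ _
  lift-upper-lower a {p} qp≈1 f (true ∷ false ∷ true ∷ v) =
    solve 4 (λ s t w p → con 0 :* s :+ con 1 :* (p :* t :+ con 0 :* w)
      := p :* (con 0 :* s :+ con 1 :* t) :+ con 0 :* w) refl _ _ _ p
  lift-upper-lower a {p} {q} qp≈1 f (false ∷ false ∷ true ∷ v) =
    solve 4 (λ s t q w → con 0 :* (con 1 :* t :+ q :* s) :+ con 1 :* w
      := con 0 :* s :+ con 1 :* w) refl _ _ q _
  lift-upper-lower a {p} qp≈1 f (true ∷ false ∷ false ∷ v) =
    solve 4 (λ p s t w → p :* s :+ con 0 :* t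
      := p :* s :+ con 0 :* (con 1 :* t :+ w)) refl p _ _ _
  lift-upper-lower a     qp≈1 f (true ∷ true ∷ true ∷ v) = refl
  lift-upper-lower a     qp≈1 f (false ∷ false ∷ false ∷ v) = refl
  lift-upper-lower a {p} {q} qp≈1 f (false ∷ true ∷ true ∷ v) =
    solve 4 (λ s t q w → con 1 :* t :+ q :* s
      := con 1 :* (con 0 :* w :+ con 1 :* t) :+ q :* s) refl _ _ q _

  -- The hypotheses compare the entries 11, 12 and 22 of the two matrix products; entry 21 is 1 on
  -- both sides.
  upper-lower : ∀ {a p q a′ p′ q′} →
    p ⊕ a ≈ p′ → a * q ≈ p′ * a′ → a′ ⊕ q′ ≈ q → (f : State (2 + n)) →
    local (upper a) (local (lower p q) f) ≐ local (lower p′ q′) (local (upper a′) f)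
  upper-lower {a = a} {p} {q} {a′} {p′} {q′} e₁₁ e₁₂ e₂₂ f (true ∷ false ∷ v) = trans
    (solve 5 (λ a p q s t → con 1 :* (p :* s :+ con 0 :* t) :+ a :* (con 1 :* s :+ q :* t)
      := (p :+ a) :* s :+ (a :* q) :* t) refl a p q _ _)
    (trans (+-cong (*-congʳ e₁₁) (*-congʳ e₁₂))
    (solve 4 (λ a p s t → p :* s :+ (p :* a) :* t
      := p :* (con 1 :* s :+ a :* t) :+ con 0 :* (con 0 :* s :+ con 1 :* t)) refl a′ p′ _ _))
  upper-lower {a = a} {p} {q} {a′} {p′} {q′} e₁₁ e₁₂ e₂₂ f (false ∷ true ∷ v) = trans
    (solve 4 (λ p q s t → con 0 :* (p :* s :+ con 0 :* t) :+ con 1 :* (con 1 :* s :+ q :* t)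
      := s :+ q :* t) refl p q _ _)
    (trans (+-congˡ (*-congʳ (sym e₂₂)))
    (solve 4 (λ a q s t → s :+ (a :+ q) :* t
      := con 1 :* (con 1 :* s :+ a :* t) :+ q :* (con 0 :* s :+ con 1 :* t)) refl a′ q′ _ _))
  upper-lower e₁₁ e₁₂ e₂₂ f (true  ∷ true  ∷ v) = refl
  upper-lower e₁₁ e₁₂ e₂₂ f (false ∷ false ∷ v) = refl

  -- The two relations above with a further factor that acts from position 3 on and so commutes with
  -- the operator on positions 1 and 2. Both orders occur, because the edges of a path decide on
  -- which side a local factor stands.
  module _ (a : Carrier) {p q : Carrier} (qp≈1 : q * p ≈ 1#) {Y : Operator (suc n)} (Y-lin : IsLinear Y) where
    private
      g : ∀ {n} → Operator (2 + n)
      g = local (lower p q)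

      e e′ : ∀ {n} → Operator (2 + n)
      e  = local (upper a)
      e′ = local (upper (a * p))

    open SetoidReasoning (stateSetoid (3 + n))

    upper-lift-lower∘ : ∀ f → e (lift (g ∘ lift Y) f) ≐ lift (g ∘ lift Y) (e′ f)
    upper-lift-lower∘ f = begin
      e (lift (g ∘ lift Y) f)       ≈⟨ ≐-cong (local-linear _) (lift-∘ g (lift Y) f) ⟩
      e (lift g (lift (lift Y) f))  ≈⟨ upper-lift-lower a qp≈1 _ ⟩
      lift g (e′ (lift (lift Y) f)) ≈⟨ ≐-cong (lift-linear (local-linear _)) (local-lift-lift _ Y-lin f) ⟩
      lift g (lift (lift Y) (e′ f)) ≈⟨ lift-∘ g (lift Y) _ ⟨
      lift (g ∘ lift Y) (e′ f)      ∎

    upper-lift-∘lower : ∀ f → e (lift (lift Y ∘ g) f) ≐ lift (lift Y ∘ g) (e′ f)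
    upper-lift-∘lower f = begin
      e (lift (lift Y ∘ g) f)       ≈⟨ ≐-cong (local-linear _) (lift-∘ (lift Y) g f) ⟩
      e (lift (lift Y) (lift g f))  ≈⟨ local-lift-lift _ Y-lin _ ⟩
      lift (lift Y) (e (lift g f))  ≈⟨ ≐-cong (lift-linear (lift-linear Y-lin)) (upper-lift-lower a qp≈1 f) ⟩
      lift (lift Y) (lift g (e′ f)) ≈⟨ lift-∘ (lift Y) g _ ⟨
      lift (lift Y ∘ g) (e′ f)      ∎

    lift-upper∘-lower : ∀ f → lift (e ∘ lift Y) (g f) ≐ g (lift (e′ ∘ lift Y) f)
    lift-upper∘-lower f = begin
      lift (e ∘ lift Y) (g f)       ≈⟨ lift-∘ e (lift Y) _ ⟩
      lift e (lift (lift Y) (g f))  ≈⟨ ≐-cong (lift-linear (local-linear _)) (local-lift-lift _ Y-lin f) ⟨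
      lift e (g (lift (lift Y) f))  ≈⟨ lift-upper-lower a qp≈1 _ ⟩
      g (lift e′ (lift (lift Y) f)) ≈⟨ ≐-cong (local-linear _) (lift-∘ e′ (lift Y) f) ⟨
      g (lift (e′ ∘ lift Y) f)      ∎

    lift-∘upper-lower : ∀ f → lift (lift Y ∘ e) (g f) ≐ g (lift (lift Y ∘ e′) f)
    lift-∘upper-lower f = begin
      lift (lift Y ∘ e) (g f)       ≈⟨ lift-∘ (lift Y) e _ ⟩
      lift (lift Y) (lift e (g f))  ≈⟨ ≐-cong (lift-linear (lift-linear Y-lin)) (lift-upper-lower a qp≈1 f) ⟩
      lift (lift Y) (g (lift e′ f)) ≈⟨ local-lift-lift _ Y-lin _ ⟨
      g (lift (lift Y) (lift e′ f)) ≈⟨ ≐-cong (local-linear _) (lift-∘ (lift Y) e′ f) ⟨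
      g (lift (lift Y ∘ e′) f)      ∎

  -- vacuum true is the indicator of the strings 1…10…0, and vacuum false of 0…0.
  vacuum : Bool → State n
  vacuum b     []          = 1#
  vacuum true  (b ∷ v)     = vacuum b v
  vacuum false (true ∷ v)  = 0#
  vacuum false (false ∷ v) = vacuum false v

  -- Both vacua are treated together: on strings that begin with 0, `vacuum true` restricts to
  -- `vacuum false`, so the passage through `lift` involves the two.
  record FixesVacuum (Y : Operator n) : Set ℓ where
    constructor fixesVacuum
    field
      fixed : ∀ b → Y (vacuum b) ≐ vacuum b

  open FixesVacuum public

  lift-fixes : {Y : Operator n} → IsLinear Y → FixesVacuum Y → FixesVacuum (lift Y)
  lift-fixes Y-lin Y-fix = fixesVacuum λ where
    true  (b ∷ v)     → fixed Y-fix b v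
    false (true ∷ v)  → null Y-lin v
    false (false ∷ v) → fixed Y-fix false v

  -- The vacua are built from highest weight vectors: both vanish on strings beginning with 01, and
  -- only such coefficients are added elsewhere by `upper a`.
  upper-fixes : ∀ a → FixesVacuum (local {n} (upper a))
  upper-fixes a = fixesVacuum λ where
    true  (true  ∷ false ∷ v) → solve 2 (λ a z → con 1 :* z :+ a :* con 0 := z) refl a _
    true  (false ∷ true  ∷ v) → solve 1 (λ z → con 0 :* z :+ con 1 :* con 0 := con 0) refl _
    true  (true  ∷ true  ∷ v) → refl
    true  (false ∷ false ∷ v) → refl
    false (true  ∷ false ∷ v) → solve 1 (λ a → con 1 :* con 0 :+ a :* con 0 := con 0) refl a
    false (false ∷ true  ∷ v) → solve 0 (con 0 :* con 0 :+ con 1 :* con 0 := con 0) refl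
    false (true  ∷ true  ∷ v) → refl
    false (false ∷ false ∷ v) → refl

  ∘-fixes : {Y Z : Operator n} → IsLinear Y → FixesVacuum Y → FixesVacuum Z → FixesVacuum (Y ∘ Z)
  ∘-fixes Y-lin Y-fix Z-fix = fixesVacuum λ b v → trans (≐-cong Y-lin (fixed Z-fix b) v) (fixed Y-fix b v)

  record Preserves {p} (Pos : Carrier → Set p) (Y : Operator n) : Set (c ⊔ p) where
    constructor preserves
    field
      preserved : ∀ {f} → (∀ v → Pos (f v)) → ∀ v → Pos (Y f v)

  open Preserves public

  module _ {p} {Pos : Carrier → Set p} where

    id-preserves : Preserves {n} Pos id
    id-preserves = preserves id

    ∘-preserves : {Y Z : Operator n} → Preserves Pos Y → Preserves Pos Z → Preserves Pos (Y ∘ Z)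
    ∘-preserves Y-pos Z-pos = preserves (preserved Y-pos ∘ preserved Z-pos)

    lift-preserves : {Y : Operator n} → Preserves Pos Y → Preserves Pos (lift Y)
    lift-preserves Y-pos = preserves λ { f-pos (b ∷ v) → preserved Y-pos (λ w → f-pos (b ∷ w)) v }

  record IsSubsemiring {p} (Pos : Carrier → Set p) : Set (c ⊔ ℓ ⊔ p) where
    field
      resp   : ∀ {y z} → y ≈ z → Pos y → Pos z
      0-pos  : Pos 0#
      1-pos  : Pos 1#
      +-pos  : ∀ {y z} → Pos y → Pos z → Pos (y ⊕ z)
      *-pos  : ∀ {y z} → Pos y → Pos z → Pos (y * z)

    upper-preserves : ∀ {a} → Pos a → Preserves Pos (local {n} (upper a))
    upper-preserves a-pos = preserves λ where
      f-pos (true  ∷ false ∷ v) → +-pos (*-pos 1-pos (f-pos _)) (*-pos a-pos (f-pos _))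
      f-pos (false ∷ true  ∷ v) → +-pos (*-pos 0-pos (f-pos _)) (*-pos 1-pos (f-pos _))
      f-pos (true  ∷ true  ∷ v) → f-pos _
      f-pos (false ∷ false ∷ v) → f-pos _

    lower-preserves : ∀ {p q} → Pos p → Pos q → Preserves Pos (local {n} (lower p q))
    lower-preserves p-pos q-pos = preserves λ where
      f-pos (true  ∷ false ∷ v) → +-pos (*-pos p-pos (f-pos _)) (*-pos 0-pos (f-pos _))
      f-pos (false ∷ true  ∷ v) → +-pos (*-pos 1-pos (f-pos _)) (*-pos q-pos (f-pos _))
      f-pos (true  ∷ true  ∷ v) → f-pos _
      f-pos (false ∷ false ∷ v) → f-pos _

    vacuum-pos : ∀ b (v : Vec Bool n) → Pos (vacuum b v)
    vacuum-pos b     []          = 1-pos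
    vacuum-pos true  (b ∷ v)     = vacuum-pos b v
    vacuum-pos false (true ∷ v)  = 0-pos
    vacuum-pos false (false ∷ v) = vacuum-pos false v

-- Transfer operators of a path, over an abstract time line.

module Transfer {c ℓ i} (K : Field c ℓ) (I : Set i) (next : I → I) where
  open Field K hiding (zero) renaming (_+_ to _⊕_)
  open Fock commutativeSemiring
  open NaturalSolver commutativeSemiring using (solve; _:=_; _:+_; _:*_)

  private
    variable
      k : ℕ
      t t′ : I

  -- Time offers only `next`, so that the same argument serves ℤ with the successor and ℤ with the
  -- predecessor. A downward edge is therefore written from `next t` to `t`.
  data Adjacent : I → I → Set i where
    flat : Adjacent t t
    up   : Adjacent t (next t)
    down : Adjacent (next t) t

  -- The endpoint [ t ] is an extra vertex, on the boundary line R_{r+1} = 1.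
  data Path : ℕ → I → Set i where
    [_]  : ∀ t → Path zero t
    _∷_  : Adjacent t t′ → Path k t′ → Path (suc k) t

  vertex : Path k t → Fin k → I
  vertex {t = t} (_ ∷ _) zero    = t
  vertex         (_ ∷ P) (suc j) = vertex P j

  shift : Path k t → Path k (next t)
  shift [ t ]      = [ next t ]
  shift (flat ∷ P) = flat ∷ shift P
  shift (up ∷ P)   = up ∷ shift P
  shift (down ∷ P) = down ∷ shift P

  vertex-shift : ∀ (P : Path k t) j → vertex (shift P) j ≡ next (vertex P j)
  vertex-shift (flat ∷ P) zero    = ≡.refl
  vertex-shift (up ∷ P)   zero    = ≡.refl
  vertex-shift (down ∷ P) zero    = ≡.refl
  vertex-shift (flat ∷ P) (suc j) = vertex-shift P j
  vertex-shift (up ∷ P)   (suc j) = vertex-shift P j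
  vertex-shift (down ∷ P) (suc j) = vertex-shift P j

  System : ℕ → Set (c ⊔ ℓ ⊔ i)
  System k = Fin (2 + k) → I → Nonzero

  value : Nonzero → Carrier
  value = proj₁

  inverseʳ : ∀ z → value z * z ⁻¹ ≈ 1#
  inverseʳ (z , z≉0) = proj₂ (inverse z z≉0)

  -- Row zero is left free so that `tail` stays within systems: there row zero is the former first
  -- row, which is not constantly 1.
  record IsSystem (x : System k) : Set (i ⊔ ℓ) where
    field
      boundary   : ∀ t → value (x (fromℕ (suc k)) t) ≈ 1#
      recurrence : ∀ j t → value (x ⟨ j ⟩ (next (next t))) * value (x ⟨ j ⟩ t)
        ≈ value (x ⟨ j ⟩ (next t)) ^ 2 ⊕ value (x ⟨ j ⟩+1 (next t)) * value (x ⟨ j ⟩-1 (next t))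

  open IsSystem

  tail : System (suc k) → System k
  tail x = x ∘ suc

  tail-isSystem : {x : System (suc k)} → IsSystem x → IsSystem (tail x)
  tail-isSystem s = record { boundary = boundary s ; recurrence = recurrence s ∘ suc }

  head : System k → I → Nonzero
  head x = x (suc zero)

  ratio ratio⁻¹ : (I → Nonzero) → I → Carrier
  ratio   y t = value (y (next t)) * y t ⁻¹
  ratio⁻¹ y t = value (y t) * y (next t) ⁻¹

  growth : (I → Nonzero) → I → Matrix
  growth y t = lower (ratio y t) (ratio⁻¹ y t)

  -- With `u` and `w` the neighbouring values in the recurrence, this is the difference of two
  -- consecutive ratios of `y`.
  weight : Carrier → (I → Nonzero) → I → Carrier → Carrier
  weight u y t w = u * w * (y t ⁻¹ * y (next t) ⁻¹)

  -- For a downward edge the local factor stands on the right: the neighbour lags one step behind,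
  -- and `sweep` has to advance it before the local exchange.
  G : System k → Path k t → Operator (suc k)
  G x [ _ ]                 = id
  G x (_∷_ {t = t} flat P)  = local (growth (head x) t) ∘ lift (G (tail x) P)
  G x (_∷_ {t = t} up P)    = local (growth (head x) t) ∘ lift (G (tail x) P)
  G x (_∷_ {t = t} down P)  = lift (G (tail x) P) ∘ local (growth (head x) t)

  -- u is the factor contributed by the left neighbour x₀; see sweep for the value it takes.
  E : Carrier → System k → Path k t → Operator (suc k)
  E u x [ _ ] = id
  E u x (_∷_ {t = t} flat P) =
    local (upper (weight u (head x) t (value (head (tail x) (next t)))))
      ∘ lift (E (value (head x t)) (tail x) P)
  E u x (_∷_ {t = t} up P) =
    lift (E (value (head x (next t))) (tail x) P)
      ∘ local (upper (weight u (head x) t (value (head (tail x) (next t)))))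
  E u x (_∷_ {t = t} down P) =
    local (upper (weight u (head x) t (value (head (tail x) t))))
      ∘ lift (E (value (head x t)) (tail x) P)

  G-linear : (x : System k) (P : Path k t) → IsLinear (G x P)
  G-linear x [ _ ]      = id-linear
  G-linear x (flat ∷ P) = ∘-linear (local-linear _) (lift-linear (G-linear (tail x) P))
  G-linear x (up ∷ P)   = ∘-linear (local-linear _) (lift-linear (G-linear (tail x) P))
  G-linear x (down ∷ P) = ∘-linear (lift-linear (G-linear (tail x) P)) (local-linear _)

  E-linear : ∀ u (x : System k) (P : Path k t) → IsLinear (E u x P)
  E-linear u x [ _ ]      = id-linear
  E-linear u x (flat ∷ P) = ∘-linear (local-linear _) (lift-linear (E-linear _ (tail x) P))
  E-linear u x (up ∷ P)   = ∘-linear (lift-linear (E-linear _ (tail x) P)) (local-linear _)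
  E-linear u x (down ∷ P) = ∘-linear (local-linear _) (lift-linear (E-linear _ (tail x) P))

  E-fixes : ∀ u (x : System k) (P : Path k t) → FixesVacuum (E u x P)
  E-fixes u x [ _ ]      = fixesVacuum λ b v → refl
  E-fixes u x (flat ∷ P) = ∘-fixes (local-linear _) (upper-fixes _)
    (lift-fixes (E-linear _ (tail x) P) (E-fixes _ (tail x) P))
  E-fixes u x (up ∷ P)   = ∘-fixes (lift-linear (E-linear _ (tail x) P))
    (lift-fixes (E-linear _ (tail x) P) (E-fixes _ (tail x) P)) (upper-fixes _)
  E-fixes u x (down ∷ P) = ∘-fixes (local-linear _) (upper-fixes _)
    (lift-fixes (E-linear _ (tail x) P) (E-fixes _ (tail x) P))

  E-cong : ∀ {u u′} → u ≈ u′ → (x : System k) (P : Path k t) → ∀ f → E u x P f ≐ E u′ x P f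
  E-cong e x [ _ ]      f v = refl
  E-cong e x (flat ∷ P) f = upper-cong (*-congʳ (*-congʳ e)) _
  E-cong e x (up ∷ P)   f = ≐-cong (lift-linear (E-linear _ (tail x) P)) (upper-cong (*-congʳ (*-congʳ e)) f)
  E-cong e x (down ∷ P) f = upper-cong (*-congʳ (*-congʳ e)) _

  cancel-inverse : ∀ y z → value z * (y * z ⁻¹) ≈ y
  cancel-inverse y z = trans
    (solve 3 (λ a y b → a :* (y :* b) := (a :* b) :* y) refl (value z) y (z ⁻¹))
    (trans (*-congʳ (inverseʳ z)) (*-identityˡ y))

  ratio-inverse : ∀ y t → ratio⁻¹ y t * ratio y t ≈ 1#
  ratio-inverse y t = trans
    (solve 4 (λ a b d e → (a :* b) :* (d :* e) := (a :* e) :* (d :* b)) refl _ _ _ _)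
    (trans (*-cong (inverseʳ (y t)) (inverseʳ (y (next t)))) (*-identityˡ 1#))

  ratio-boundary : ∀ {y} → (∀ t → value (y t) ≈ 1#) → ∀ t → ratio y t ≈ 1#
  ratio-boundary {y} e t = trans (*-congʳ (trans (e (next t)) (sym (e t)))) (inverseʳ (y t))

  weight-ratioˡ : ∀ u y t w p → weight u y t w * p ≈ weight (u * p) y t w
  weight-ratioˡ u y t w p =
    solve 4 (λ u w z p → u :* w :* z :* p := u :* p :* w :* z) refl u w _ p

  weight-ratioʳ : ∀ u y t z s → weight u y t (value (z s)) * ratio z s ≈ weight u y t (value (z (next s)))
  weight-ratioʳ u y t z s = trans
    (solve 5 (λ u w v a b → u :* w :* v :* (a :* b) := u :* (w :* (a :* b)) :* v) refl u _ _ _ _)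
    (*-congʳ (*-congˡ (cancel-inverse _ (z s))))

  value-ratio : ∀ y t → value (y t) * ratio y t ≈ value (y (next t))
  value-ratio y t = cancel-inverse _ (y t)

  -- Only the first local factor of `G` overlaps the upper factor; the others act further right and
  -- commute with it. At the endpoint no factor is present, in accordance with the boundary row
  -- having ratio 1.
  upper-G : ∀ a {x : System k} → IsSystem x → (P : Path k t) → ∀ f →
    local (upper a) (lift (G x P) f) ≐ lift (G x P) (local (upper (a * ratio (head x) t)) f)
  upper-G {t = t} a {x} s [ _ ] f = begin
    local (upper a) (lift id f)  ≈⟨ ≐-cong (local-linear (upper a)) (lift-id f) ⟩
    local (upper a) f            ≈⟨ upper-cong (trans (sym (*-identityʳ a)) (*-congˡ (sym (ratio-boundary {head x} (boundary s) t)))) f ⟩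
    local (upper (a * ratio (head x) t)) f            ≈⟨ lift-id _ ⟨
    lift id (local (upper (a * ratio (head x) t)) f)  ∎
    where open SetoidReasoning (stateSetoid _)
  upper-G a {x} s (flat ∷ P) = upper-lift-lower∘ a (ratio-inverse (head x) _) (G-linear (tail x) P)
  upper-G a {x} s (up ∷ P)   = upper-lift-lower∘ a (ratio-inverse (head x) _) (G-linear (tail x) P)
  upper-G a {x} s (down ∷ P) = upper-lift-∘lower a (ratio-inverse (head x) _) (G-linear (tail x) P)

  -- Only the first factor of `E` meets the lower one, and its weight is linear in `u`, so the
  -- scaling by `p` is absorbed into `u`.
  E-lower : ∀ u {p q} → q * p ≈ 1# → (x : System k) (P : Path k t) → ∀ f →
    lift (E u x P) (local (lower p q) f) ≐ local (lower p q) (lift (E (u * p) x P) f)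
  E-lower u {p} {q} qp≈1 x [ _ ] f = begin
    lift id (local (lower p q) f)  ≈⟨ lift-id _ ⟩
    local (lower p q) f            ≈⟨ ≐-cong (local-linear (lower p q)) (lift-id f) ⟨
    local (lower p q) (lift id f)  ∎
    where open SetoidReasoning (stateSetoid _)
  E-lower u {p} {q} qp≈1 x (flat ∷ P) f = begin
    lift (E u x (flat ∷ P)) (local (lower p q) f)
      ≈⟨ lift-upper∘-lower _ qp≈1 (E-linear _ (tail x) P) f ⟩
    local (lower p q) (lift (local (upper (_ * p)) ∘ lift (E _ (tail x) P)) f)
      ≈⟨ ≐-cong (local-linear (lower p q)) (lift-cong (λ h → upper-cong (weight-ratioˡ u (head x) _ _ p) _) f) ⟩
    local (lower p q) (lift (E (u * p) x (flat ∷ P)) f) ∎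
    where open SetoidReasoning (stateSetoid _)
  E-lower u {p} {q} qp≈1 x (up ∷ P) f = begin
    lift (E u x (up ∷ P)) (local (lower p q) f)
      ≈⟨ lift-∘upper-lower _ qp≈1 (E-linear _ (tail x) P) f ⟩
    local (lower p q) (lift (lift (E _ (tail x) P) ∘ local (upper (_ * p))) f)
      ≈⟨ ≐-cong (local-linear (lower p q)) (lift-cong (λ h → ≐-cong (lift-linear (E-linear _ (tail x) P))
           (upper-cong (weight-ratioˡ u (head x) _ _ p) h)) f) ⟩
    local (lower p q) (lift (E (u * p) x (up ∷ P)) f) ∎
    where open SetoidReasoning (stateSetoid _)
  E-lower u {p} {q} qp≈1 x (down ∷ P) f = begin
    lift (E u x (down ∷ P)) (local (lower p q) f)
      ≈⟨ lift-upper∘-lower _ qp≈1 (E-linear _ (tail x) P) f ⟩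
    local (lower p q) (lift (local (upper (_ * p)) ∘ lift (E _ (tail x) P)) f)
      ≈⟨ ≐-cong (local-linear (lower p q)) (lift-cong (λ h → upper-cong (weight-ratioˡ u (head x) _ _ p) _) f) ⟩
    local (lower p q) (lift (E (u * p) x (down ∷ P)) f) ∎
    where open SetoidReasoning (stateSetoid _)

  -- Passing the growth factor of a row advances that row by one step wherever it serves as left
  -- neighbour.
  E-growth : ∀ (y : I → Nonzero) s (x : System k) (P : Path k t) → ∀ f →
    lift (E (value (y s)) x P) (local (growth y s) f) ≐ local (growth y s) (lift (E (value (y (next s))) x P) f)
  E-growth y s x P f = begin
    lift (E (value (y s)) x P) (local (growth y s) f)
      ≈⟨ E-lower (value (y s)) (ratio-inverse y s) x P f ⟩
    local (growth y s) (lift (E (value (y s) * ratio y s) x P) f)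
      ≈⟨ ≐-cong (local-linear (growth y s)) (lift-cong (E-cong (value-ratio y s) x P) f) ⟩
    local (growth y s) (lift (E (value (y (next s))) x P) f) ∎
    where open SetoidReasoning (stateSetoid _)

  -- The counterpart of `E-growth` on the other side: now the right neighbour in the weight advances
  -- by one step.
  weight-G : ∀ u y s {x : System k} → IsSystem x → (P : Path k t) → ∀ f →
    local (upper (weight u y s (value (head x t)))) (lift (G x P) f)
      ≐ lift (G x P) (local (upper (weight u y s (value (head x (next t))))) f)
  weight-G u y s {x} x-sys P f = begin
    local (upper (weight u y s _)) (lift (G x P) f)
      ≈⟨ upper-G _ x-sys P f ⟩
    lift (G x P) (local (upper (weight u y s _ * ratio (head x) _)) f)
      ≈⟨ ≐-cong (lift-linear (G-linear x P)) (upper-cong (weight-ratioʳ u y s (head x) _) f) ⟩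
    lift (G x P) (local (upper (weight u y s _)) f) ∎
    where open SetoidReasoning (stateSetoid _)

  -- The local exchange as the Q-system relation.

  module _ (u w : Carrier) (y : I → Nonzero) (t : I)
    (rec : value (y (next (next t))) * value (y t) ≈ value (y (next t)) ^ 2 ⊕ w * u) where

    private
      x₀ = value (y t)
      x₁ = value (y (next t))
      x₂ = value (y (next (next t)))
      i₀ = y t ⁻¹
      i₁ = y (next t) ⁻¹
      i₂ = y (next (next t)) ⁻¹

      rec′ : x₁ * x₁ ⊕ u * w ≈ x₂ * x₀
      rec′ = trans (+-cong (*-congˡ (sym (*-identityʳ x₁))) (*-comm u w)) (sym rec)

    -- This and `inverse-step` are the recurrence divided by `x₀ * x₁` and by `x₁ * x₂`; both sides
    -- of `weight-step` equal `u * w` divided by the square of `x₁`.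
    growth-step : ratio y t ⊕ weight u y t w ≈ ratio y (next t)
    growth-step = begin
      x₁ * i₀ ⊕ u * w * (i₀ * i₁)                ≈⟨ +-congʳ (trans (sym (*-identityˡ _)) (*-congʳ (sym (inverseʳ (y (next t)))))) ⟩
      x₁ * i₁ * (x₁ * i₀) ⊕ u * w * (i₀ * i₁)    ≈⟨ solve 5 (λ x₁ i₁ i₀ u w → x₁ :* i₁ :* (x₁ :* i₀) :+ u :* w :* (i₀ :* i₁) := (x₁ :* x₁ :+ u :* w) :* (i₀ :* i₁)) refl x₁ i₁ i₀ u w ⟩
      (x₁ * x₁ ⊕ u * w) * (i₀ * i₁)              ≈⟨ *-congʳ rec′ ⟩
      x₂ * x₀ * (i₀ * i₁)                        ≈⟨ solve 4 (λ x₂ x₀ i₀ i₁ → x₂ :* x₀ :* (i₀ :* i₁) := x₀ :* i₀ :* (x₂ :* i₁)) refl x₂ x₀ i₀ i₁ ⟩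
      x₀ * i₀ * (x₂ * i₁)                        ≈⟨ trans (*-congʳ (inverseʳ (y t))) (*-identityˡ _) ⟩
      x₂ * i₁                                    ∎
      where open SetoidReasoning setoid

    weight-step : weight u y t w * ratio⁻¹ y t ≈ ratio y (next t) * weight u y (next t) w
    weight-step = begin
      u * w * (i₀ * i₁) * (x₀ * i₁)    ≈⟨ solve 5 (λ u w i₀ i₁ x₀ → u :* w :* (i₀ :* i₁) :* (x₀ :* i₁) := x₀ :* i₀ :* (u :* w :* i₁ :* i₁)) refl u w i₀ i₁ x₀ ⟩
      x₀ * i₀ * (u * w * i₁ * i₁)      ≈⟨ *-congʳ (trans (inverseʳ (y t)) (sym (inverseʳ (y (next (next t)))))) ⟩
      x₂ * i₂ * (u * w * i₁ * i₁)      ≈⟨ solve 5 (λ u w i₁ x₂ i₂ → x₂ :* i₂ :* (u :* w :* i₁ :* i₁) := x₂ :* i₁ :* (u :* w :* (i₁ :* i₂))) refl u w i₁ x₂ i₂ ⟩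
      x₂ * i₁ * (u * w * (i₁ * i₂))    ∎
      where open SetoidReasoning setoid

    inverse-step : weight u y (next t) w ⊕ ratio⁻¹ y (next t) ≈ ratio⁻¹ y t
    inverse-step = begin
      u * w * (i₁ * i₂) ⊕ x₁ * i₂                ≈⟨ +-congˡ (trans (sym (*-identityˡ _)) (*-congʳ (sym (inverseʳ (y (next t)))))) ⟩
      u * w * (i₁ * i₂) ⊕ x₁ * i₁ * (x₁ * i₂)    ≈⟨ solve 5 (λ x₁ i₁ i₂ u w → u :* w :* (i₁ :* i₂) :+ x₁ :* i₁ :* (x₁ :* i₂) := (x₁ :* x₁ :+ u :* w) :* (i₁ :* i₂)) refl x₁ i₁ i₂ u w ⟩
      (x₁ * x₁ ⊕ u * w) * (i₁ * i₂)              ≈⟨ *-congʳ rec′ ⟩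
      x₂ * x₀ * (i₁ * i₂)                        ≈⟨ solve 4 (λ x₂ x₀ i₁ i₂ → x₂ :* x₀ :* (i₁ :* i₂) := x₂ :* i₂ :* (x₀ :* i₁)) refl x₂ x₀ i₁ i₂ ⟩
      x₂ * i₂ * (x₀ * i₁)                        ≈⟨ trans (*-congʳ (inverseʳ (y (next (next t))))) (*-identityˡ _) ⟩
      x₀ * i₁                                    ∎
      where open SetoidReasoning setoid

    weight-growth : ∀ {n} (f : State (2 + n)) →
      local (upper (weight u y t w)) (local (growth y t) f)
        ≐ local (growth y (next t)) (local (upper (weight u y (next t) w)) f)
    weight-growth = upper-lower growth-step weight-step inverse-step

  -- Induction on the path. `u` is the value of row zero at the middle time of the first row's
  -- recurrence, so `weight-growth` applies at the first vertex; the remaining moves update the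
  -- neighbours until the weights are those of the shifted path.
  sweep : ∀ {u} {x : System k} → IsSystem x → (P : Path k t) →
    u ≈ value (x zero (next t)) →
    ∀ f → E u x P (G x P f) ≐ G x (shift P) (E u x (shift P) f)
  sweep x-sys [ _ ] u≈ f v = refl
  sweep {k = suc k} {u = u} {x} x-sys (_∷_ {t = t} flat P) u≈ f = begin
    e a (lift (E y₀ x′ P) (g t (lift (G x′ P) f)))
      -- Both the induction hypothesis and the shifted path want `y₁` as left neighbour of the tail.
      ≈⟨ ≐-cong (local-linear _) (E-growth y t x′ P _) ⟩
    e a (g t (lift (E y₁ x′ P) (lift (G x′ P) f)))
      ≈⟨ weight-growth u z₁ y t rec _ ⟩
    g (next t) (e a′ (lift (E y₁ x′ P) (lift (G x′ P) f)))
      ≈⟨ ≐-cong (∘-linear (local-linear _) (local-linear _)) (lift-exchange (sweep (tail-isSystem x-sys) P refl) f) ⟩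
    g (next t) (e a′ (lift (G x′ (shift P)) (lift (E y₁ x′ (shift P)) f)))
      ≈⟨ ≐-cong (local-linear _) (weight-G u y (next t) (tail-isSystem x-sys) (shift P) _) ⟩
    G x (shift (flat ∷ P)) (E u x (shift (flat ∷ P)) f) ∎
    where
    open SetoidReasoning (stateSetoid _)
    x′ = tail x
    y  = head x
    y₀ = value (y t)
    y₁ = value (y (next t))
    z₁ = value (head x′ (next t))
    a  = weight u y t z₁
    a′ = weight u y (next t) z₁
    e : Carrier → Operator (2 + k)
    e b = local (upper b)
    g : I → Operator (2 + k)
    g s = local (growth y s)
    rec = trans (recurrence x-sys zero t) (+-congˡ (*-congˡ (sym u≈)))
  sweep {k = suc k} {u = u} {x} x-sys (_∷_ {t = t} up P) u≈ f = begin
    lift (E y₁ x′ P) (e a (g t (lift (G x′ P) f)))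
      ≈⟨ ≐-cong (lift-linear (E-linear _ x′ P)) (weight-growth u z₁ y t rec _) ⟩
    lift (E y₁ x′ P) (g (next t) (e a′ (lift (G x′ P) f)))
      -- The tail starts one step later than the first vertex, so its induction hypothesis is about
      -- `y₂`.
      ≈⟨ E-growth y (next t) x′ P _ ⟩
    g (next t) (lift (E y₂ x′ P) (e a′ (lift (G x′ P) f)))
      ≈⟨ ≐-cong (∘-linear (local-linear _) (lift-linear (E-linear _ x′ P))) (weight-G u y (next t) (tail-isSystem x-sys) P f) ⟩
    g (next t) (lift (E y₂ x′ P) (lift (G x′ P) (e a″ f)))
      ≈⟨ ≐-cong (local-linear _) (lift-exchange (sweep (tail-isSystem x-sys) P refl) _) ⟩
    G x (shift (up ∷ P)) (E u x (shift (up ∷ P)) f) ∎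
    where
    open SetoidReasoning (stateSetoid _)
    x′ = tail x
    y  = head x
    y₁ = value (y (next t))
    y₂ = value (y (next (next t)))
    z₁ = value (head x′ (next t))
    a  = weight u y t z₁
    a′ = weight u y (next t) z₁
    a″ = weight u y (next t) (value (head x′ (next (next t))))
    e : Carrier → Operator (2 + k)
    e b = local (upper b)
    g : I → Operator (2 + k)
    g s = local (growth y s)
    rec = trans (recurrence x-sys zero t) (+-congˡ (*-congˡ (sym u≈)))
  sweep {k = suc k} {u = u} {x} x-sys (_∷_ {t = t} down P) u≈ f = begin
    e a (lift (E y₀ x′ P) (lift (G x′ P) (g t f)))
      -- The tail starts one step earlier, so `y₀` is already the value that the induction
      -- hypothesis asks for.
      ≈⟨ ≐-cong (local-linear _) (lift-exchange (sweep (tail-isSystem x-sys) P refl) _) ⟩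
    e a (lift (G x′ (shift P)) (lift (E y₀ x′ (shift P)) (g t f)))
      ≈⟨ weight-G u y t (tail-isSystem x-sys) (shift P) _ ⟩
    lift (G x′ (shift P)) (e a′ (lift (E y₀ x′ (shift P)) (g t f)))
      ≈⟨ ≐-cong (∘-linear (lift-linear (G-linear x′ (shift P))) (local-linear _)) (E-growth y t x′ (shift P) f) ⟩
    lift (G x′ (shift P)) (e a′ (g t (lift (E y₁ x′ (shift P)) f)))
      ≈⟨ ≐-cong (lift-linear (G-linear x′ (shift P))) (weight-growth u z₁ y t rec _) ⟩
    G x (shift (down ∷ P)) (E u x (shift (down ∷ P)) f) ∎
    where
    open SetoidReasoning (stateSetoid _)
    x′ = tail x
    y  = head x
    y₀ = value (y t)
    y₁ = value (y (next t))
    z₁ = value (head x′ (next t))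
    a  = weight u y t (value (head x′ t))
    a′ = weight u y t z₁
    e : Carrier → Operator (2 + k)
    e b = local (upper b)
    g : I → Operator (2 + k)
    g s = local (growth y s)
    rec = trans (recurrence x-sys zero t) (+-congˡ (*-congˡ (sym u≈)))

  -- top j is the string 1…10…0 with as many ones as the index α of ⟨ j ⟩.
  top : Fin k → Vec Bool (suc k)
  top {suc k} zero    = true ∷ replicate (suc k) false
  top {suc k} (suc j) = true ∷ top j

  -- Coefficients at the strings 1...10...0.

  G-zeros : (x : System k) (P : Path k t) → ∀ f → G x P f (replicate (suc k) false) ≈ f (replicate (suc k) false)
  G-zeros x [ _ ]      f = refl
  G-zeros x (flat ∷ P) f = G-zeros (tail x) P _
  G-zeros x (up ∷ P)   f = G-zeros (tail x) P _
  G-zeros x (down ∷ P) f = G-zeros (tail x) P _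

  -- `top j` begins with 1, so `local` sees the pattern 11; the case split merely exposes this bit.
  local-top : ∀ A f (j : Fin k) → local A f (true ∷ top j) ≈ f (true ∷ top j)
  local-top A f zero    = refl
  local-top A f (suc j) = refl

  growth-top : ∀ y t z w → value (y t) * (ratio y t * z ⊕ 0# * w) ≈ value (y (next t)) * z
  growth-top y t z w = begin
    value (y t) * (ratio y t * z ⊕ 0# * w)  ≈⟨ *-congˡ (trans (+-congˡ (zeroˡ w)) (+-identityʳ _)) ⟩
    value (y t) * (ratio y t * z)           ≈⟨ *-assoc _ _ _ ⟨
    value (y t) * ratio y t * z             ≈⟨ *-congʳ (value-ratio y t) ⟩
    value (y (next t)) * z                  ∎
    where open SetoidReasoning setoid

  -- Lower triangular factors rescale highest weight coefficients. On `top j` a factor of `G` sees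
  -- 11 or 00 and acts trivially, except the one at `j`, which sees 10 and contributes its ratio.
  G-top : (x : System k) (P : Path k t) → ∀ f j →
    value (x ⟨ j ⟩ (vertex P j)) * G x P f (top j) ≈ value (x ⟨ j ⟩ (next (vertex P j))) * f (top j)
  G-top x (flat ∷ P) f zero    = trans (growth-top (head x) _ _ _) (*-congˡ (G-zeros (tail x) P _))
  G-top x (up ∷ P)   f zero    = trans (growth-top (head x) _ _ _) (*-congˡ (G-zeros (tail x) P _))
  G-top x (down ∷ P) f zero    = trans (*-congˡ (G-zeros (tail x) P _)) (growth-top (head x) _ _ _)
  G-top x (flat ∷ P) f (suc j) = trans (*-congˡ (local-top _ _ j)) (G-top (tail x) P _ j)
  G-top x (up ∷ P)   f (suc j) = trans (*-congˡ (local-top _ _ j)) (G-top (tail x) P _ j)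
  G-top x (down ∷ P) f (suc j) = trans (G-top (tail x) P _ j) (*-congˡ (local-top _ f j))

  vacuum-top : (j : Fin k) → vacuum true (top j) ≈ 1#
  vacuum-top {suc k} zero = vacuum-zeros (suc k)
    where
    vacuum-zeros : ∀ n → vacuum false (replicate n false) ≈ 1#
    vacuum-zeros zero    = refl
    vacuum-zeros (suc n) = vacuum-zeros n
  vacuum-top {suc k} (suc j) = vacuum-top j

  N : System k → Path k t → Operator (suc k)
  N x P = G x P ∘ E 1# x P

  N-linear : (x : System k) (P : Path k t) → IsLinear (N x P)
  N-linear x P = ∘-linear (G-linear x P) (E-linear 1# x P)

  module _ {x : System k} (x-sys : IsSystem x) (x₀≈1 : ∀ t → value (x zero t) ≈ 1#) where

    -- By `sweep`, `E` followed on its right by `N` of the path becomes `N` of the shifted path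
    -- followed by the same `E`; this is repeated for each factor.
    E-fold : (P : Path k t) → ∀ n f → E 1# x P (fold f (N x P) n) ≐ fold (E 1# x P f) (N x (shift P)) n
    E-fold P zero    f v = refl
    E-fold P (suc n) f = begin
      E 1# x P (N x P (fold f (N x P) n))            ≈⟨ sweep x-sys P (sym (x₀≈1 _)) _ ⟩
      N x (shift P) (E 1# x P (fold f (N x P) n))    ≈⟨ ≐-cong (N-linear x (shift P)) (E-fold P n f) ⟩
      fold (E 1# x P f) (N x (shift P)) (suc n)      ∎
      where open SetoidReasoning (stateSetoid (suc k))

    fold-≐ : {Y : Operator (suc k)} → IsLinear Y → ∀ n {f h} → f ≐ h → fold f Y n ≐ fold h Y n
    fold-≐ Y-lin zero    e = e
    fold-≐ Y-lin (suc n) e = ≐-cong Y-lin (fold-≐ Y-lin n e)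

    propagation : ∀ n (P : Path k t) j →
      value (x ⟨ j ⟩ (vertex P j)) * fold (vacuum true) (N x P) n (top j)
        ≈ value (x ⟨ j ⟩ (fold (vertex P j) next n))
    propagation zero    P j = trans (*-congˡ (vacuum-top j)) (*-identityʳ _)
    propagation (suc n) P j = begin
      value (x ⟨ j ⟩ (vertex P j)) * G x P (E 1# x P (fold (vacuum true) (N x P) n)) (top j)
        ≈⟨ G-top x P _ j ⟩
      value (x ⟨ j ⟩ (next (vertex P j))) * E 1# x P (fold (vacuum true) (N x P) n) (top j)
        -- `E` travels to the right end, where the vacuum absorbs it; what remains is the case `n`
        -- for the shifted path.
        ≈⟨ *-congˡ (trans (E-fold P n (vacuum true) (top j))
             (fold-≐ (N-linear x (shift P)) n (fixed (E-fixes 1# x P) true) (top j))) ⟩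
      value (x ⟨ j ⟩ (next (vertex P j))) * fold (vacuum true) (N x (shift P)) n (top j)
        ≡⟨ ≡.cong (λ s → value (x ⟨ j ⟩ s) * fold (vacuum true) (N x (shift P)) n (top j)) (vertex-shift P j) ⟨
      value (x ⟨ j ⟩ (vertex (shift P) j)) * fold (vacuum true) (N x (shift P)) n (top j)
        ≈⟨ propagation n (shift P) j ⟩
      value (x ⟨ j ⟩ (fold (vertex (shift P) j) next n))
        ≡⟨ ≡.cong (λ s → value (x ⟨ j ⟩ (fold s next n))) (vertex-shift P j) ⟩
      value (x ⟨ j ⟩ (fold (next (vertex P j)) next n))
        ≡⟨ ≡.cong (value ∘ x ⟨ j ⟩) (fold-pull n) ⟩
      value (x ⟨ j ⟩ (fold (vertex P j) next (suc n))) ∎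
      where
      open SetoidReasoning setoid
      fold-pull : ∀ n {s} → fold (next s) next n ≡ next (fold s next n)
      fold-pull zero    = ≡.refl
      fold-pull (suc n) = ≡.cong next (fold-pull n)

  -- Positivity of the matrix entries and of all later values.

  module Positivity {p} {Pos : Carrier → Set p} (isSubsemiring : IsSubsemiring Pos) where
    open IsSubsemiring isSubsemiring

    -- Inverses are included because the ratios and weights divide by the initial data.
    Unit : Nonzero → Set p
    Unit z = Pos (value z) × Pos (z ⁻¹)

    Seed : System k → Path k t → Set p
    Seed x P = ∀ j → Unit (x ⟨ j ⟩ (vertex P j)) × Unit (x ⟨ j ⟩ (next (vertex P j)))

    head-pos : {x : System k} → IsSystem x → (P : Path k t) → Seed x P →
      Pos (value (head x t)) × Pos (value (head x (next t)))
    head-pos x-sys [ t ]    s = resp (sym (boundary x-sys t)) 1-pos , resp (sym (boundary x-sys (next t))) 1-pos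
    head-pos x-sys (_ ∷ P)  s = proj₁ (proj₁ (s zero)) , proj₁ (proj₂ (s zero))

    growth-pos : ∀ {n} y t → Unit (y t) × Unit (y (next t)) → Preserves Pos (local {n} (growth y t))
    growth-pos y t ((z , z⁻¹) , (w , w⁻¹)) = lower-preserves (*-pos w z⁻¹) (*-pos z w⁻¹)

    weight-pos : ∀ {n u w} y t → Pos u → Pos w → Unit (y t) × Unit (y (next t)) →
      Preserves Pos (local {n} (upper (weight u y t w)))
    weight-pos y t u w ((_ , z⁻¹) , (_ , w⁻¹)) = upper-preserves (*-pos (*-pos u w) (*-pos z⁻¹ w⁻¹))

    G-preserves : (x : System k) (P : Path k t) → Seed x P → Preserves Pos (G x P)
    G-preserves x [ _ ]      s = id-preserves
    G-preserves x (flat ∷ P) s = ∘-preserves (growth-pos (head x) _ (s zero)) (lift-preserves (G-preserves (tail x) P (s ∘ suc)))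
    G-preserves x (up ∷ P)   s = ∘-preserves (growth-pos (head x) _ (s zero)) (lift-preserves (G-preserves (tail x) P (s ∘ suc)))
    G-preserves x (down ∷ P) s = ∘-preserves (lift-preserves (G-preserves (tail x) P (s ∘ suc))) (growth-pos (head x) _ (s zero))

    -- Beyond the given `u`, each neighbour in a weight is taken at its own vertex or one step
    -- later, whatever the edge, so it belongs to the seed or to the boundary row.
    E-preserves : ∀ {u} → Pos u → {x : System k} → IsSystem x → (P : Path k t) → Seed x P → Preserves Pos (E u x P)
    E-preserves u x-sys [ _ ] s = id-preserves
    E-preserves u {x} x-sys (flat ∷ P) s = ∘-preserves
      (weight-pos (head x) _ u (proj₂ (head-pos (tail-isSystem x-sys) P (s ∘ suc))) (s zero))
      (lift-preserves (E-preserves (proj₁ (proj₁ (s zero))) (tail-isSystem x-sys) P (s ∘ suc)))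
    E-preserves u {x} x-sys (up ∷ P) s = ∘-preserves
      (lift-preserves (E-preserves (proj₁ (proj₂ (s zero))) (tail-isSystem x-sys) P (s ∘ suc)))
      (weight-pos (head x) _ u (proj₁ (head-pos (tail-isSystem x-sys) P (s ∘ suc))) (s zero))
    E-preserves u {x} x-sys (down ∷ P) s = ∘-preserves
      (weight-pos (head x) _ u (proj₂ (head-pos (tail-isSystem x-sys) P (s ∘ suc))) (s zero))
      (lift-preserves (E-preserves (proj₁ (proj₁ (s zero))) (tail-isSystem x-sys) P (s ∘ suc)))

    system-pos : {x : System k} → IsSystem x → (∀ t → value (x zero t) ≈ 1#) →
      (P : Path k t) → Seed x P → ∀ j n → Pos (value (x ⟨ j ⟩ (fold (vertex P j) next n)))
    system-pos {x = x} x-sys x₀≈1 P s j n = resp (propagation x-sys x₀≈1 n P j)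
      (*-pos (proj₁ (proj₁ (s j))) (fold-pos n (top j)))
      where
      fold-pos : ∀ n v → Pos (fold (vacuum true) (N x P) n v)
      fold-pos zero    = vacuum-pos true
      fold-pos (suc n) = preserved (∘-preserves (G-preserves x P s) (E-preserves 1-pos x-sys P s)) (fold-pos n)

  fromVertices : (m : Vector I (suc k)) → (∀ j → Adjacent (m (inject₁ j)) (m (suc j))) → Path (suc k) (m zero)
  -- The extra endpoint lies on the constant boundary row, so a flat edge to it can always be
  -- chosen.
  fromVertices {k = zero}  m adj = flat ∷ [ m zero ]
  fromVertices {k = suc k} m adj = adj zero ∷ fromVertices (m ∘ suc) (adj ∘ suc)

  vertex-fromVertices : ∀ (m : Vector I (suc k)) adj j → vertex (fromVertices m adj) j ≡ m j
  vertex-fromVertices {k = zero}  m adj zero    = ≡.refl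
  vertex-fromVertices {k = suc k} m adj zero    = ≡.refl
  vertex-fromVertices {k = suc k} m adj (suc j) = vertex-fromVertices (m ∘ suc) (adj ∘ suc) j

-- The subsemiring of Laurent polynomials with nonnegative coefficients.

module Laurent {c ℓ} (K : Field c ℓ) {k : ℕ} (x : Vector (Field.Nonzero K) k) where
  open Field K hiding (zero) renaming (_+_ to _⊕_)
  open Fock commutativeSemiring using (IsSubsemiring)
  open NaturalSolver commutativeSemiring using (solve; _:=_; _:*_)
  open ProductProperties *-commutativeMonoid using () renaming (sum-cong-≋ to product-cong; ∑-distrib-+ to product-distrib)
  open Exp semiring using (^-homo-*; ^-congʳ)
  open SemiringMult semiring using (×-comm-*; ×-assoc-*)
  open MonoidMult +-monoid using () renaming (×-congʳ to ·-congʳ; ×-assocˡ to ·-assocˡ; ×-homo-1 to ·-homo-1)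

  -- Integer addition of mixed signs reduces to `_⊖_`, so this is the mixed case of `^ℤ-homo-*`;
  -- factors cancel in pairs.
  ^ℤ-⊖ : ∀ z m n → z ^ℤ (m ℤ.⊖ n) ≈ proj₁ z ^ m * (z ⁻¹) ^ n
  ^ℤ-⊖ z m       zero    = sym (*-identityʳ _)
  ^ℤ-⊖ z zero    (suc n) = sym (*-identityˡ _)
  ^ℤ-⊖ z (suc m) (suc n) = begin
    z ^ℤ (suc m ℤ.⊖ suc n)                                ≡⟨ ≡.cong (z ^ℤ_) (ℤ.[1+m]⊖[1+n]≡m⊖n m n) ⟩
    z ^ℤ (m ℤ.⊖ n)                                        ≈⟨ ^ℤ-⊖ z m n ⟩
    proj₁ z ^ m * (z ⁻¹) ^ n                              ≈⟨ *-identityˡ _ ⟨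
    1# * (proj₁ z ^ m * (z ⁻¹) ^ n)                       ≈⟨ *-congʳ (proj₂ (inverse (proj₁ z) (proj₂ z))) ⟨
    proj₁ z * z ⁻¹ * (proj₁ z ^ m * (z ⁻¹) ^ n)           ≈⟨ solve 4 (λ a b d e → a :* b :* (d :* e) := a :* d :* (b :* e)) refl _ _ _ _ ⟩
    proj₁ z * proj₁ z ^ m * (z ⁻¹ * (z ⁻¹) ^ n)           ∎
    where open SetoidReasoning setoid

  ^ℤ-homo-* : ∀ z a b → z ^ℤ (a ℤ.+ b) ≈ z ^ℤ a * z ^ℤ b
  ^ℤ-homo-* z (ℤ.+ m)    (ℤ.+ n)    = ^-homo-* (proj₁ z) m n
  ^ℤ-homo-* z (ℤ.+ m)    ℤ.-[1+ n ] = ^ℤ-⊖ z m (suc n)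
  ^ℤ-homo-* z ℤ.-[1+ m ] (ℤ.+ n)    = trans (^ℤ-⊖ z n (suc m)) (*-comm _ _)
  ^ℤ-homo-* z ℤ.-[1+ m ] ℤ.-[1+ n ] = trans
    (^-congʳ (z ⁻¹) (≡.cong suc (≡.sym (ℕ.+-suc m n)))) (^-homo-* (z ⁻¹) (suc m) (suc n))

  Positive : Carrier → Set ℓ
  Positive z = ∃ λ f → z ≈ evalLaurent K f x

  positive-resp : ∀ {y z} → y ≈ z → Positive y → Positive z
  positive-resp y≈z (f , e) = f , trans (sym y≈z) e

  monomial : Vec ℤ k → Carrier
  monomial e = product (λ i → x i ^ℤ lookup e i)

  monomial-* : ∀ d e → monomial d * monomial e ≈ monomial (zipWith ℤ._+_ d e)
  monomial-* d e = trans (sym (product-distrib (λ i → x i ^ℤ lookup d i) (λ i → x i ^ℤ lookup e i)))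
    (product-cong λ i → trans (sym (^ℤ-homo-* (x i) (lookup d i) (lookup e i)))
      (reflexive (≡.cong (x i ^ℤ_) (≡.sym (lookup-zipWith ℤ._+_ i d e)))))

  positive-term : ∀ a e → Positive (a · monomial e)
  positive-term a e = (a , e) ∷ [] , sym (+-identityʳ _)

  positive-monomial : ∀ e → Positive (monomial e)
  positive-monomial e = positive-resp (·-homo-1 _) (positive-term 1 e)

  product-one : ∀ {n} (y : Vector Nonzero n) → product (λ i → y i ^ℤ lookup (replicate n ℤ.0ℤ) i) ≈ 1#
  product-one {zero}  y = refl
  product-one {suc n} y = trans (*-identityˡ _) (product-one (y ∘ suc))

  product-update : ∀ {n} (y : Vector Nonzero n) j s →
    product (λ i → y i ^ℤ lookup (replicate n ℤ.0ℤ [ j ]≔ s) i) ≈ y j ^ℤ s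
  product-update {suc n} y zero    s = trans (*-congˡ (product-one (y ∘ suc))) (*-identityʳ _)
  product-update {suc n} y (suc j) s = trans (*-identityˡ _) (product-update (y ∘ suc) j s)

  positive-power : ∀ j s → Positive (x j ^ℤ s)
  positive-power j s = positive-resp (product-update x j s) (positive-monomial (replicate k ℤ.0ℤ [ j ]≔ s))

  positive-unit : ∀ j → Positive (proj₁ (x j)) × Positive (x j ⁻¹)
  positive-unit j = positive-resp (*-identityʳ _) (positive-power j ℤ.1ℤ) , positive-resp (*-identityʳ _) (positive-power j ℤ.-1ℤ)

  positive-+ : ∀ {y z} → Positive y → Positive z → Positive (y ⊕ z)
  positive-+ {y} {z} (f , y≈) (g , z≈) = f ++ g , trans (+-cong y≈ z≈) (eval-++ f)
    where
    eval-++ : ∀ f → evalLaurent K f x ⊕ evalLaurent K g x ≈ evalLaurent K (f ++ g) x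
    eval-++ []      = +-identityˡ _
    eval-++ (t ∷ f) = trans (+-assoc _ _ _) (+-congˡ (eval-++ f))

  positive-term-* : ∀ a d b e → Positive ((a · monomial d) * (b · monomial e))
  positive-term-* a d b e = positive-resp (begin
    (a ℕ.* b) · monomial (zipWith ℤ._+_ d e)    ≈⟨ ·-congʳ (a ℕ.* b) (monomial-* d e) ⟨
    (a ℕ.* b) · (monomial d * monomial e)       ≈⟨ ·-assocˡ _ a b ⟨
    a · (b · (monomial d * monomial e))         ≈⟨ ·-congʳ a (×-comm-* b _ _) ⟨
    a · (monomial d * (b · monomial e))         ≈⟨ ×-assoc-* a _ _ ⟨
    (a · monomial d) * (b · monomial e)         ∎)
    (positive-term (a ℕ.* b) (zipWith ℤ._+_ d e))
    where open SetoidReasoning setoid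

  positive-0 : Positive 0#
  positive-0 = [] , refl

  positive-* : ∀ {y z} → Positive y → Positive z → Positive (y * z)
  positive-* (f , y≈) (g , z≈) = positive-resp (sym (*-cong y≈ z≈)) (eval-* f)
    where
    term-* : ∀ a d g → Positive ((a · monomial d) * evalLaurent K g x)
    term-* a d []            = positive-resp (sym (zeroʳ _)) positive-0
    term-* a d ((b , e) ∷ g) = positive-resp (sym (distribˡ _ _ _))
      (positive-+ (positive-term-* a d b e) (term-* a d g))

    eval-* : ∀ f → Positive (evalLaurent K f x * evalLaurent K g x)
    eval-* []            = positive-resp (sym (zeroˡ _)) positive-0
    eval-* ((a , d) ∷ f) = positive-resp (sym (distribʳ _ _ _)) (positive-+ (term-* a d g) (eval-* f))

  positive-isSubsemiring : IsSubsemiring Positive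
  positive-isSubsemiring = record
    { resp  = positive-resp
    ; 0-pos = positive-0
    ; 1-pos = positive-resp (product-one x) (positive-monomial (replicate k ℤ.0ℤ))
    ; +-pos = positive-+
    ; *-pos = positive-*
    }

-- Integer time in both directions, and the edges of a Motzkin path.

next prev : ℤ → ℤ
next n = n ℤ.+ ℤ.1ℤ
prev n = n ℤ.- ℤ.1ℤ

prev-next : ∀ n → prev (next n) ≡ n
prev-next n = ≡.trans (ℤ.+-assoc n ℤ.1ℤ ℤ.-1ℤ) (ℤ.+-identityʳ n)

next-prev : ∀ n → next (prev n) ≡ n
next-prev n = ≡.trans (ℤ.+-assoc n ℤ.-1ℤ ℤ.1ℤ) (ℤ.+-identityʳ n)

fold-next : ∀ n k → fold n next k ≡ n ℤ.+ ℤ.+ k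
fold-next n zero    = ≡.sym (ℤ.+-identityʳ n)
fold-next n (suc k) = ≡.trans (≡.cong next (fold-next n k))
  (≡.trans (ℤ.+-assoc n (ℤ.+ k) ℤ.1ℤ) (≡.cong (λ j → n ℤ.+ ℤ.+ j) (ℕ.+-comm k 1)))

fold-prev : ∀ n k → fold (next n) prev (suc k) ≡ n ℤ.- ℤ.+ k
fold-prev n zero    = ≡.trans (prev-next n) (≡.sym (ℤ.+-identityʳ n))
fold-prev n (suc k) = ≡.trans (≡.cong prev (fold-prev n k))
  (≡.trans (ℤ.+-assoc n (ℤ.- ℤ.+ k) ℤ.-1ℤ)
  (≡.cong (λ i → n ℤ.+ i) (≡.trans (≡.sym (ℤ.neg-distrib-+ (ℤ.+ k) ℤ.1ℤ)) (≡.cong (λ j → ℤ.- ℤ.+ j) (ℕ.+-comm k 1)))))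

+-difference : ∀ a b → b ≡ a ℤ.+ (b ℤ.- a)
+-difference a b = ≡.sym (≡.trans (ℤ.+-comm a (b ℤ.- a))
  (≡.trans (ℤ.+-assoc b (ℤ.- a) a) (≡.trans (≡.cong (λ i → b ℤ.+ i) (ℤ.+-inverseˡ a)) (ℤ.+-identityʳ b))))

reachable : ∀ a b → (∃ λ k → fold a next k ≡ b) ⊎ (∃ λ k → fold (next a) prev k ≡ b)
reachable a b with b ℤ.- a | +-difference a b
... | ℤ.+ k      | b≡ = inj₁ (k , ≡.trans (fold-next a k) (≡.sym b≡))
-- One step leads from `next a` to `a`, and `suc k` more lead to `b`.
... | ℤ.-[1+ k ] | b≡ = inj₂ (2 + k , ≡.trans (fold-prev a (suc k)) (≡.sym b≡))

-- The edge types before a direction of time is chosen; they are translated into `Adjacent` once for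
-- `next` and once for `prev`.
data Close (a : ℤ) : ℤ → Set where
  same   : Close a a
  above  : Close a (next a)
  below  : Close a (prev a)

close : ∀ a b → ℤ.∣ b ℤ.- a ∣ ≤ 1 → Close a b
close a b ∣b-a∣≤1 with b ℤ.- a | +-difference a b
... | ℤ.+ 0      | b≡ = ≡.subst (Close a) (≡.sym (≡.trans b≡ (ℤ.+-identityʳ a))) same
... | ℤ.+ 1      | b≡ = ≡.subst (Close a) (≡.sym b≡) above
... | ℤ.-[1+ 0 ] | b≡ = ≡.subst (Close a) (≡.sym b≡) below
close a b (s≤s ()) | ℤ.+ suc (suc _) | _
close a b (s≤s ()) | ℤ.-[1+ suc _ ] | _

motzkin-close : ∀ {k} (m : Vector ℤ (suc k)) → IsMotzkinPath m → ∀ j → Close (m (inject₁ j)) (m (suc j))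
motzkin-close m motzkin j = close _ _ (motzkin (inject₁ j) (suc j) (≡.cong suc (≡.sym (toℕ-inject₁ j))))

-- Laurent positivity of the Q-system, forward and backward in time.

module _ {c ℓ} {k : ℕ} (K : RationalFunctionField (suc k + suc k) c ℓ) where
  open RationalFunctionField K hiding (zero) renaming (_+_ to _⊕_)

  module _ {R : Fin (3 + k) → ℤ → Nonzero} (isQSystem : IsQSystem K R)
    {m : Vector ℤ (suc k)} (motzkin : IsMotzkinPath m) where

    open IsQSystem isQSystem
    open Laurent asField (initialData K R m)

    private
      module Forward  = Transfer asField ℤ next
      module Backward = Transfer asField ℤ prev

      -- `Unit` does not involve time, so the forward copy serves both directions.
      open Forward.Positivity positive-isSubsemiring using (Unit)

    unit-now : ∀ j → Unit (R ⟨ j ⟩ (m j))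
    unit-now j = ≡.subst Unit (lookup-++ˡ (λ i → R ⟨ i ⟩ (m i)) (λ i → R ⟨ i ⟩ (next (m i))) j) (positive-unit (j ↑ˡ suc k))

    unit-next : ∀ j → Unit (R ⟨ j ⟩ (next (m j)))
    unit-next j = ≡.subst Unit (lookup-++ʳ (λ i → R ⟨ i ⟩ (m i)) (λ i → R ⟨ i ⟩ (next (m i))) j) (positive-unit (suc k ↑ʳ j))

    forward-pos : ∀ j n → Positive (proj₁ (R ⟨ j ⟩ (fold (m j) next n)))
    forward-pos j n = ≡.subst (λ t → Positive (proj₁ (R ⟨ j ⟩ (fold t next n)))) (vertex≡ j)
      (Forward.Positivity.system-pos positive-isSubsemiring system lowerBoundary path seed j n)
      where
      adjacent : ∀ {a b} → Close a b → Forward.Adjacent a b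
      adjacent same      = Forward.flat
      adjacent above     = Forward.up
      adjacent {a} below = ≡.subst (λ t → Forward.Adjacent t (prev a)) (next-prev a) Forward.down

      path = Forward.fromVertices m (adjacent ∘ motzkin-close m motzkin)

      vertex≡ : ∀ j → Forward.vertex path j ≡ m j
      vertex≡ = Forward.vertex-fromVertices m (adjacent ∘ motzkin-close m motzkin)

      system : Forward.IsSystem R
      system = record
        { boundary   = upperBoundary
        ; recurrence = λ j t → trans
            (*-congˡ (reflexive (≡.cong (proj₁ ∘ R ⟨ j ⟩) (≡.sym (prev-next t)))))
            (recurrence j (next t))
        }

      seed : ∀ j → Unit (R ⟨ j ⟩ (Forward.vertex path j)) × Unit (R ⟨ j ⟩ (next (Forward.vertex path j)))
      seed j = ≡.subst (λ t → Unit (R ⟨ j ⟩ t) × Unit (R ⟨ j ⟩ (next t))) (≡.sym (vertex≡ j)) (unit-now j , unit-next j)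

    -- The recurrence is invariant under reversal of time, which exchanges m and m + 1.
    backward-pos : ∀ j n → Positive (proj₁ (R ⟨ j ⟩ (fold (next (m j)) prev n)))
    backward-pos j n = ≡.subst (λ t → Positive (proj₁ (R ⟨ j ⟩ (fold t prev n)))) (vertex≡ j)
      (Backward.Positivity.system-pos positive-isSubsemiring system lowerBoundary path seed j n)
      where
      adjacent : ∀ {a b} → Close a b → Backward.Adjacent (next a) (next b)
      adjacent same      = Backward.flat
      -- Reversing time turns rising edges into falling ones and conversely.
      adjacent {a} above = ≡.subst (λ t → Backward.Adjacent t (next (next a))) (prev-next (next a)) Backward.down
      adjacent {a} below = ≡.subst (Backward.Adjacent (next a)) (≡.trans (prev-next a) (≡.sym (next-prev a))) Backward.up

      path = Backward.fromVertices (next ∘ m) (adjacent ∘ motzkin-close m motzkin)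

      vertex≡ : ∀ j → Backward.vertex path j ≡ next (m j)
      vertex≡ = Backward.vertex-fromVertices (next ∘ m) (adjacent ∘ motzkin-close m motzkin)

      system : Backward.IsSystem R
      system = record
        { boundary   = upperBoundary
        ; recurrence = λ j t → trans
            -- Reversal swaps the outer factors of the recurrence, here centred at `prev t`.
            (*-comm _ _)
            (trans (*-congʳ (reflexive (≡.cong (proj₁ ∘ R ⟨ j ⟩) (≡.sym (next-prev t)))))
            (recurrence j (prev t)))
        }

      seed : ∀ j → Unit (R ⟨ j ⟩ (Backward.vertex path j)) × Unit (R ⟨ j ⟩ (prev (Backward.vertex path j)))
      seed j = ≡.subst (λ t → Unit (R ⟨ j ⟩ t) × Unit (R ⟨ j ⟩ (prev t))) (≡.sym (vertex≡ j))
        (unit-next j , ≡.subst (Unit ∘ R ⟨ j ⟩) (≡.sym (prev-next (m j))) (unit-now j))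

    qSystem-pos : ∀ j n → Positive (proj₁ (R ⟨ j ⟩ n))
    qSystem-pos j n with reachable (m j) n
    ... | inj₁ (l , e) = ≡.subst (Positive ∘ proj₁ ∘ R ⟨ j ⟩) e (forward-pos j l)
    ... | inj₂ (l , e) = ≡.subst (Positive ∘ proj₁ ∘ R ⟨ j ⟩) e (backward-pos j l)

mainTheorem14 : ∀ {c ℓ} (r : ℕ) → 1 ≤ r →
    (K : RationalFunctionField (r + r) c ℓ) →
    let open RationalFunctionField K hiding (_+_) in
    (R : Fin (2 + r) → ℤ → Nonzero) → IsQSystem K R →
    (m : Vector ℤ r) → IsMotzkinPath m →
    (α : Fin r) (n : ℤ) →
    ∃ λ (f : LaurentPolynomialℕ (r + r)) →
      proj₁ (R ⟨ α ⟩ n) ≈ evalLaurent asField f (initialData K R m)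
mainTheorem14 (suc k) _ K R isQSystem m motzkin = qSystem-pos K isQSystem motzkin
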